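{- Let $G$ be a nontrivial connected graph and let $\Gamma$ be a family of graphs such that $V(F)=V$ for every $F\in\Gamma$. Consider any function $h:E(G)\to\Gamma$. Then $G\otimes_h\Gamma$ is connected if and only if the intersection graph obtained from $\mathcal{F}(G,\Gamma,h)$ is connected.
   Context: All graphs are finite and simple. A graph is nontrivial if it has at least two vertices. Let $G$ be a graph, $\Gamma$ a family of graphs all having the same vertex set $V$, and $h:E(G)\to\Gamma$ a function. The product $G\otimes_h\Gamma$ is the graph with vertex set $V(G)\times V$ in which $(a,x)(b,y)$ is an edge if and only if $ab\in E(G)$ and $xy\in E(h(ab))$. The intersection graph obtained from a family of sets $\{S_i: i\in I\}$ is the graph with one vertex $v_i$ for each $i\in I$ and an edge $v_iv_j$ (for $i\ne j$) if and only if $S_i\cap S_j\neq\emptyset$. For each edge $ab\in E(G)$ and each connected component $C$ of $h(ab)$, define subsets $S_a(C),S_b(C)$ of $V(G)\times V$ as follows. If $C$ is bipartite with stable sets (bipartition classes) $V_1(C)$ and $V_2(C)$, then $$S_a(C)=(\{a\}\times V_1(C))\cup(\{b\}\times V_2(C)),\qquad S_b(C)=(\{a\}\times V_2(C))\cup(\{b\}\times V_1(C)).$$ (For a component consisting of a single vertex, one of the two stable sets is empty.) If $C$ is nonbipartite, then $S_a(C)=S_b(C)=\{a,b\}\times V(C)$. The family $\mathcal{F}(G,\Gamma,h)$ of subsets of $V(G)\times V$ is $$\mathcal{F}(G,\Gamma,h)=\bigcup_{a\in V(G),\ b\in N_G(a)}\{S_a(C): C \text{ is a component of } h(ab)\},$$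 where $N_G(a)$ is the set of neighbors of $a$ in $G$; thus for each edge $ab$ and each component $C$ of $h(ab)$ both $S_a(C)$ and $S_b(C)$ belong to the family. -}

module Defs where

open import Level using (Level; _⊔_; 0ℓ) renaming (suc to lsuc)
open import Data.Fin using (Fin)
open import Data.Nat using (ℕ)
open import Data.Product using (Σ; ∃; ∃-syntax; _×_; _,_; proj₁; proj₂; swap)
open import Data.Sum using (_⊎_; inj₁; inj₂)
open import Function using (_∘_; _⟶ₛ_; Func)
open import Relation.Binary
  using (Rel; Setoid; Symmetric; Irreflexive; Decidable; _Respects₂_)
import Relation.Binary.Construct.On as On
open import Relation.Binary.PropositionalEquality
  using (_≡_; refl; sym; trans; cong; subst; setoid; resp₂)
open import Relation.Nullary using (¬_)
open import Relation.Unary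
  using (Pred; _∈_; _∪_; _≐_; _≬_; _⊥_; ｛_｝; _⟨×⟩_)
open import Relation.Unary.Relation.Binary.Equality using (≐-setoid)

private
  variable
    a c i ℓ r : Level
    n m : ℕ

-- Simple graphs. The vertices form a setoid because an intersection graph has
-- sets as vertices, and these are identified when they have the same elements.

record Graph (V : Setoid c ℓ) (r : Level) : Set (c ⊔ ℓ ⊔ lsuc r) where
  open Setoid V using (_≈_) renaming (Carrier to Vertex)
  field
    Adj        : Rel Vertex r
    Adj-resp-≈ : Adj Respects₂ _≈_
    Adj-sym    : Symmetric Adj
    Adj-irrefl : Irreflexive _≈_ Adj

  data Walk : Rel Vertex (c ⊔ ℓ ⊔ r) where
    stop : ∀ {u v} → u ≈ v → Walk u v
    step : ∀ {u v w} → Adj u v → Walk v w → Walk u w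

  -- The graph without vertices is not connected.
  Connected : Set (c ⊔ ℓ ⊔ r)
  Connected = Vertex × (∀ u v → Walk u v)

-- A finite graph is given on Fin n. Classically adj? is no restriction.

record FiniteGraph (n : ℕ) : Set₁ where
  field
    graph : Graph (setoid (Fin n)) 0ℓ
  open Graph graph public
  field
    adj? : Decidable Adj

open FiniteGraph

-- E(G): an edge is presented by an adjacent ordered pair (u , v), and equality
-- of edges forgets the order and the proof of adjacency.

Edges : FiniteGraph n → Setoid 0ℓ 0ℓ
Edges {n} G = record
  { Carrier       = Edge
  ; _≈_           = _≈ᴱ_
  ; isEquivalence = record
    { refl  = inj₁ refl
    ; sym   = λ where
        (inj₁ p) → inj₁ (sym p)
        (inj₂ p) → inj₂ (cong swap (sym p))
    ; trans = λ where
        (inj₁ p) (inj₁ q) → inj₁ (trans p q)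
        (inj₁ p) (inj₂ q) → inj₂ (trans p q)
        (inj₂ p) (inj₁ q) → inj₂ (trans p (cong swap q))
        (inj₂ p) (inj₂ q) → inj₁ (trans p (cong swap q))
    }
  }
  where
  Edge : Set
  Edge = ∃[ u ] ∃[ v ] Adj G u v

  ends : Edge → Fin n × Fin n
  ends (u , v , _) = u , v

  _≈ᴱ_ : Rel Edge 0ℓ
  e ≈ᴱ f = ends e ≡ ends f ⊎ ends e ≡ swap (ends f)

module _ (G : FiniteGraph n) {I : Set i} (Γ : I → FiniteGraph m)
         (h : Edges G ⟶ₛ setoid I) where

  label : ∀ {u v} → Adj G u v → FiniteGraph m
  label {u} {v} uv = Γ (Func.to h (u , v , uv))

  product : Graph (setoid (Fin n × Fin m)) 0ℓ
  product = record
    { Adj        = Adj⊗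
    ; Adj-resp-≈ = resp₂ Adj⊗
    ; Adj-sym    = λ { {_ , x} {_ , y} (uv , xy) →
        Adj-sym G uv ,
        subst (λ k → Adj (Γ k) y x) (Func.cong h (inj₂ refl))
              (Adj-sym (label uv) xy) }
    ; Adj-irrefl = λ { refl (uu , _) → Adj-irrefl G refl uu }
    }
    where
    Adj⊗ : Rel (Fin n × Fin m) 0ℓ
    Adj⊗ (u , x) (v , y) = Σ (Adj G u v) λ uv → Adj (label uv) x y

IsComponent : FiniteGraph m → Pred (Fin m) 0ℓ → Set
IsComponent F C = ∃[ x ] C ≐ Walk F x

Stable : FiniteGraph m → Pred (Fin m) 0ℓ → Set
Stable F W = ∀ {x y} → x ∈ W → y ∈ W → ¬ Adj F x y

-- V₁ and V₂ are the stable sets of a bipartition of the subgraph induced by C;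
-- one of them may be empty.

record IsBipartition (F : FiniteGraph m) (C V₁ V₂ : Pred (Fin m) 0ℓ) : Set where
  field
    cover    : C ≐ V₁ ∪ V₂
    disjoint : V₁ ⊥ V₂
    stable₁  : Stable F V₁
    stable₂  : Stable F V₂

Bipartite : FiniteGraph m → Pred (Fin m) 0ℓ → Set₁
Bipartite F C = ∃[ V₁ ] ∃[ V₂ ] IsBipartition F C V₁ V₂

-- IsS F u v C S: S is S_u(C) or S_v(C), where C is a component of F = h(uv).
-- A connected C has a unique bipartition up to naming the classes, and both
-- ways of naming them are allowed: one gives S_u(C), the other S_v(C).

data IsS (F : FiniteGraph m) (u v : Fin n) (C : Pred (Fin m) 0ℓ)
         (S : Pred (Fin n × Fin m) 0ℓ) : Set₁ where
  bipartite    : ∀ {V₁ V₂} → IsBipartition F C V₁ V₂ →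
                 S ≐ (｛ u ｝ ⟨×⟩ V₁) ∪ (｛ v ｝ ⟨×⟩ V₂) → IsS F u v C S
  nonbipartite : ¬ Bipartite F C →
                 S ≐ ((｛ u ｝ ∪ ｛ v ｝) ⟨×⟩ C) → IsS F u v C S

module _ (G : FiniteGraph n) {I : Set i} (Γ : I → FiniteGraph m)
         (h : Edges G ⟶ₛ setoid I) where

  𝓕 : Pred (Pred (Fin n × Fin m) 0ℓ) (lsuc 0ℓ)
  𝓕 S = ∃[ u ] ∃[ v ] Σ (Adj G u v) λ uv →
        ∃[ C ] IsComponent (label G Γ h uv) C × IsS (label G Γ h uv) u v C S

-- A collection of sets indexed by itself: equal sets are the same index.

members : {X : Set a} → Pred (Pred X a) r → Setoid (lsuc a ⊔ r) a
members {a = a} {X = X} 𝒮 = On.setoid (≐-setoid X a) (proj₁ {B = 𝒮})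

intersectionGraph : {X : Set a} (𝒮 : Pred (Pred X a) r) → Graph (members 𝒮) a
intersectionGraph {a = a} 𝒮 = record
  { Adj        = Meet
  ; Adj-resp-≈ =
      (λ { {i} {j} {k} j≈k (i≉j , x , x∈i , x∈j) →
           (λ i≈k → i≉j (≈.trans {i} {k} {j} i≈k (swap j≈k))) ,
           x , x∈i , proj₁ j≈k x∈j }) ,
      (λ { {i} {j} {k} j≈k (j≉i , x , x∈j , x∈i) →
           (λ k≈i → j≉i (≈.trans {j} {k} {i} j≈k k≈i)) ,
           x , proj₁ j≈k x∈j , x∈i })
  ; Adj-sym    = λ { (i≉j , x , x∈i , x∈j) → i≉j ∘ swap , x , x∈j , x∈i }
  ; Adj-irrefl = λ i≈j (i≉j , _) → i≉j i≈j
  }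
  where
  module ≈ = Setoid (members 𝒮)

  Meet : Rel (∃ 𝒮) a
  Meet (S , _) (T , _) = ¬ (S ≐ T) × S ≬ T

{-# OPTIONS --safe #-}

-- Let D be the bipartite double cover of F = h(uv), drawn inside the product on
-- {u , v} × V.  Every member of 𝓕 coming from uv is a component of D: a
-- bipartite C lifts to two components S_u(C) and S_v(C), a nonbipartite C to
-- one.  Hence each member of 𝓕 is connected in the product, and each edge of
-- the product lies in a member of 𝓕, so that walks can be carried over in both
-- directions.  To argue constructively, reachability in a finite graph is
-- decided first; this also decides which components are bipartite.

module Submission where

open import Defs
open import Level using (Level; _⊔_; 0ℓ)
open import Data.Bool using (Bool; true; false; not; if_then_else_)
import Data.Bool.Properties as Bool
open import Data.Fin using (Fin; zero; suc)
import Data.Fin.Properties as Fin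
open import Data.List using (List; []; _∷_; allFin; cartesianProduct)
open import Data.List.Membership.Propositional using () renaming (_∈_ to _∈ˡ_)
open import Data.List.Membership.Propositional.Properties
  using (∈-allFin; ∈-cartesianProduct⁺)
open import Data.List.Relation.Unary.Any using (here; there)
open import Data.Nat using (ℕ; _≤_; s≤s)
open import Data.Product using (∃; ∃-syntax; _×_; _,_; proj₁; proj₂)
open import Data.Product.Properties using (≡-dec)
open import Data.Sum using (_⊎_; inj₁; inj₂; [_,_])
open import Function using (_⟶ₛ_; _⇔_; mk⇔; _∘_; id)
open import Relation.Binary using (Setoid; Decidable; DecidableEquality)
open import Relation.Binary.PropositionalEquality
  using (_≡_; _≢_; refl; sym; setoid; resp₂)
open import Relation.Nullary using (¬_; Dec; yes; no; contradiction)
open import Relation.Nullary.Decidable using (map′; _×-dec_; _⊎-dec_; _→-dec_)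
import Relation.Unary as U
open import Relation.Unary using (Pred; _∈_; _∪_; _≐_; _≬_; ｛_｝; _⟨×⟩_)
open import Relation.Unary.Properties using (_∪?_; _×?_)

open Graph using (stop; step)

private
  variable
    a c ℓ r : Level
    m n : ℕ

-- Walks in an arbitrary graph, and decidable reachability.

module Walks {V : Setoid c ℓ} (G : Graph V r) where
  open Setoid V using (_≈_) renaming (refl to ≈-refl; sym to ≈-sym; trans to ≈-trans)
  open Graph G using (Adj; Adj-resp-≈; Adj-sym; Walk)

  walk-respˡ-≈ : ∀ {u v w} → u ≈ v → Walk v w → Walk u w
  walk-respˡ-≈ u≈v (stop v≈w)   = stop (≈-trans u≈v v≈w)
  walk-respˡ-≈ u≈v (step vx xw) = step (proj₂ Adj-resp-≈ (≈-sym u≈v) vx) xw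

  walk-trans : ∀ {u v w} → Walk u v → Walk v w → Walk u w
  walk-trans (stop u≈v)   vw = walk-respˡ-≈ u≈v vw
  walk-trans (step ux xv) vw = step ux (walk-trans xv vw)

  walk-edge : ∀ {u v} → Adj u v → Walk u v
  walk-edge uv = step uv (stop ≈-refl)

  walk-sym : ∀ {u v} → Walk u v → Walk v u
  walk-sym (stop u≈v)   = stop (≈-sym u≈v)
  walk-sym (step ux xv) = walk-trans (walk-sym xv) (walk-edge (Adj-sym ux))

-- Warshall's algorithm: Via zs x y says that y is reachable from x with all
-- interior vertices in zs.
module Reachability {A : Set a} (G : Graph (setoid A) r)
                    (_≟_ : DecidableEquality A) (adj? : Decidable (Graph.Adj G)) where
  open Graph G using (Adj; Walk)
  open Walks G

  Via : List A → A → A → Set (a ⊔ r)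
  Via []       x y = x ≡ y ⊎ Adj x y
  Via (z ∷ zs) x y = Via zs x y ⊎ (Via zs x z × Via zs z y)

  via? : ∀ zs → Decidable (Via zs)
  via? []       x y = (x ≟ y) ⊎-dec adj? x y
  via? (z ∷ zs) x y = via? zs x y ⊎-dec (via? zs x z ×-dec via? zs z y)

  via-base : ∀ zs {x y} → x ≡ y ⊎ Adj x y → Via zs x y
  via-base []       e = e
  via-base (_ ∷ zs) e = inj₁ (via-base zs e)

  via-trans : ∀ zs {x y z} → z ∈ˡ zs → Via zs x z → Via zs z y → Via zs x y
  via-trans (_ ∷ _)  (here refl) xz zy = inj₂ ([ id , proj₁ ] xz , [ id , proj₂ ] zy)
  via-trans (_ ∷ zs) (there z∈) (inj₁ xz)       (inj₁ zy)       = inj₁ (via-trans zs z∈ xz zy)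
  via-trans (_ ∷ zs) (there z∈) (inj₁ xz)       (inj₂ (zw , wy)) = inj₂ (via-trans zs z∈ xz zw , wy)
  via-trans (_ ∷ zs) (there z∈) (inj₂ (xw , wz)) (inj₁ zy)       = inj₂ (xw , via-trans zs z∈ wz zy)
  via-trans (_ ∷ zs) (there z∈) (inj₂ (xw , _))  (inj₂ (_ , wy)) = inj₂ (xw , wy)

  via⇒walk : ∀ zs {x y} → Via zs x y → Walk x y
  via⇒walk []       (inj₁ x≡y)       = stop x≡y
  via⇒walk []       (inj₂ xy)        = walk-edge xy
  via⇒walk (_ ∷ zs) (inj₁ xy)        = via⇒walk zs xy
  via⇒walk (_ ∷ zs) (inj₂ (xz , zy)) = walk-trans (via⇒walk zs xz) (via⇒walk zs zy)

  walk⇒via : ∀ zs → (∀ z → z ∈ˡ zs) → ∀ {x y} → Walk x y → Via zs x y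
  walk⇒via zs all∈ (stop x≡y)   = via-base zs (inj₁ x≡y)
  walk⇒via zs all∈ (step xz zy) =
    via-trans zs (all∈ _) (via-base zs (inj₂ xz)) (walk⇒via zs all∈ zy)

  walk? : ∀ zs → (∀ z → z ∈ˡ zs) → Decidable Walk
  walk? zs all∈ x y = map′ (via⇒walk zs) (walk⇒via zs all∈) (via? zs x y)

-- A walk to a second vertex cannot be `stop`, so its first step gives a neighbour.
neighbour : (G : FiniteGraph n) → 2 ≤ n → FiniteGraph.Connected G →
            ∀ u → ∃[ v ] FiniteGraph.Adj G u v
neighbour {n} G 2≤n (_ , walk) u with other 2≤n u
  where
  other : 2 ≤ n → (u : Fin n) → ∃[ v ] u ≢ v
  other (s≤s (s≤s _)) zero    = suc zero , λ ()
  other (s≤s (s≤s _)) (suc _) = zero , λ ()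
... | v , u≢v with walk u v
...   | stop u≡v   = contradiction u≡v u≢v
...   | step uw _  = _ , uw

-- The bipartite double cover of a label.

side : Fin n → Fin n → Bool → Fin n
side u v p = if p then u else v

module Component (F : FiniteGraph m) where
  open FiniteGraph F hiding (stop; step)
  open Walks graph

  -- The categorical product of `F` with the complete graph on two vertices; `true` and `false`
  -- stand for the ends `u` and `v` of an edge, as `side` records.
  doubleCover : Graph (setoid (Bool × Fin m)) 0ℓ
  doubleCover = record
    { Adj        = λ (p , x) (q , y) → q ≡ not p × Adj x y
    ; Adj-resp-≈ = resp₂ _
    ; Adj-sym    = λ { (refl , xy) → sym (Bool.not-involutive _) , Adj-sym xy }
    ; Adj-irrefl = λ { refl (_ , xx) → Adj-irrefl refl xx }
    }

  open Graph doubleCover using () renaming (Walk to Walkᴰ)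
  module D = Walks doubleCover

  walk? : Decidable Walk
  walk? = Reachability.walk? graph Fin._≟_ adj? (allFin _) ∈-allFin

  walkᴰ? : Decidable Walkᴰ
  walkᴰ? = Reachability.walk? doubleCover (≡-dec Bool._≟_ Fin._≟_)
    (λ (p , x) (q , y) → (q Bool.≟ not p) ×-dec adj? x y)
    (cartesianProduct (true ∷ false ∷ []) (allFin m))
    (λ (p , x) → ∈-cartesianProduct⁺ (bool∈ p) (∈-allFin x))
    where
    bool∈ : ∀ p → p ∈ˡ true ∷ false ∷ []
    bool∈ true  = here refl
    bool∈ false = there (here refl)

  project : ∀ {p q x y} → Walkᴰ (p , x) (q , y) → Walk x y
  project (stop refl)        = stop refl
  project (step (_ , xz) zy) = step xz (project zy)

  -- The side on which the lifted walk ends depends on the parity of its length, hence the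
  -- existential.
  lift : ∀ {x y} → Walk x y → ∀ p → ∃[ q ] Walkᴰ (p , x) (q , y)
  lift (stop refl)  p = p , stop refl
  lift (step xz zy) p with lift zy (not p)
  ... | q , w = q , step (refl , xz) w

  flip : ∀ {p q x y} → Walkᴰ (p , x) (q , y) → Walkᴰ (not p , x) (not q , y)
  flip (stop refl)           = stop refl
  flip (step (refl , xz) zy) = step (refl , xz) (flip zy)

  -- A walk of doubleCover between the two lifts of x is an odd closed walk at x.
  oddClosed⇒connected : ∀ {x} → Walkᴰ (true , x) (false , x) →
                        ∀ {y} → Walk x y → ∀ p → Walkᴰ (true , x) (p , y)
  oddClosed⇒connected odd xy p with lift xy true
  oddClosed⇒connected odd xy true  | true  , w = w
  oddClosed⇒connected odd xy true  | false , w = D.walk-trans odd (flip w)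
  oddClosed⇒connected odd xy false | true  , w = D.walk-trans odd (flip w)
  oddClosed⇒connected odd xy false | false , w = w

  -- The classes are the parities of walks from `x`. A vertex in both classes, or an edge inside
  -- one, would close `w₁` and the flipped reverse of `w₂` to an odd closed walk at `x`.
  noOddClosed⇒bipartition : ∀ {x} → ¬ Walkᴰ (true , x) (false , x) →
    IsBipartition F (Walk x) (λ y → Walkᴰ (true , x) (true , y))
                             (λ y → Walkᴰ (true , x) (false , y))
  noOddClosed⇒bipartition {x} ¬odd = record
    { cover    = (λ xy → classify (lift xy true)) , [ project , project ]
    ; disjoint = λ (w₁ , w₂) → ¬odd (D.walk-trans w₁ (flip (D.walk-sym w₂)))
    ; stable₁  = λ w₁ w₂ yz →
        ¬odd (D.walk-trans (D.walk-trans w₁ (D.walk-edge (refl , yz))) (flip (D.walk-sym w₂)))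
    ; stable₂  = λ w₁ w₂ yz →
        ¬odd (D.walk-trans (D.walk-trans w₁ (D.walk-edge (refl , yz))) (flip (D.walk-sym w₂)))
    }
    where
    classify : ∀ {y} → ∃[ p ] Walkᴰ (true , x) (p , y) →
               Walkᴰ (true , x) (true , y) ⊎ Walkᴰ (true , x) (false , y)
    classify (true  , w) = inj₁ w
    classify (false , w) = inj₂ w

  -- A fixed component, its bipartitions and the sets built from it.

  module _ {C : Pred (Fin m) 0ℓ} (comp : IsComponent F C) where

    root : Fin m
    root = proj₁ comp

    C≐ : C ≐ Walk root
    C≐ = proj₂ comp

    component-walk : ∀ {x y} → x ∈ C → y ∈ C → Walk x y
    component-walk x∈C y∈C = walk-trans (walk-sym (proj₁ C≐ x∈C)) (proj₁ C≐ y∈C)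

    component-adj : ∀ {x y} → x ∈ C → Adj x y → y ∈ C
    component-adj x∈C xy = proj₂ C≐ (walk-trans (proj₁ C≐ x∈C) (walk-edge xy))

    component? : U.Decidable C
    component? x = map′ (proj₂ C≐) (proj₁ C≐) (walk? _ x)

    module _ {V₁ V₂ : Pred (Fin m) 0ℓ} (bip : IsBipartition F C V₁ V₂) where
      open IsBipartition bip

      -- Indexing by `Bool` matches the classes with the sides of `doubleCover`: each step of a walk
      -- there changes both.
      class : Bool → Pred (Fin m) 0ℓ
      class p = if p then V₁ else V₂

      class⊆C : ∀ p {x} → x ∈ class p → x ∈ C
      class⊆C true  = proj₂ cover ∘ inj₁
      class⊆C false = proj₂ cover ∘ inj₂

      class-adj : ∀ p {x y} → x ∈ class p → Adj x y → y ∈ class (not p)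
      class-adj true x∈ xy with proj₁ cover (component-adj (class⊆C true x∈) xy)
      ... | inj₁ y∈V₁ = contradiction xy (stable₁ x∈ y∈V₁)
      ... | inj₂ y∈V₂ = y∈V₂
      class-adj false x∈ xy with proj₁ cover (component-adj (class⊆C false x∈) xy)
      ... | inj₁ y∈V₁ = y∈V₁
      ... | inj₂ y∈V₂ = contradiction xy (stable₂ x∈ y∈V₂)

      class-walk : ∀ {p q x y} → Walkᴰ (p , x) (q , y) → x ∈ class p → y ∈ class q
      class-walk (stop refl)               x∈ = x∈
      class-walk {p} (step (refl , xz) zy) x∈ = class-walk zy (class-adj p x∈ xz)

      class-unique : ∀ p q {x} → x ∈ class p → x ∈ class q → p ≡ q
      class-unique true  true  _   _   = refl
      class-unique true  false x∈₁ x∈₂ = contradiction (x∈₁ , x∈₂) disjoint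
      class-unique false true  x∈₂ x∈₁ = contradiction (x∈₁ , x∈₂) disjoint
      class-unique false false _   _   = refl

      -- A walk inside `C` lifts from side `p` to some side `r`; `class-walk` puts `y` in class `r`,
      -- and disjointness forces `r` to be `q`.
      bipartite-connected : ∀ p q {x y} → x ∈ class p → y ∈ class q → Walkᴰ (p , x) (q , y)
      bipartite-connected p q x∈ y∈
        with lift (component-walk (class⊆C p x∈) (class⊆C q y∈)) p
      ... | r , w with class-unique r q (class-walk w x∈) y∈
      ...   | refl = w

      -- The classes are arbitrary predicates, but `C` is decidable and `cover` names a class for
      -- each of its vertices.
      class₁? : U.Decidable V₁
      class₁? x with component? x
      ... | no  x∉C = no (x∉C ∘ class⊆C true)
      ... | yes x∈C with proj₁ cover x∈C
      ...   | inj₁ x∈V₁ = yes x∈V₁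
      ...   | inj₂ x∈V₂ = no λ x∈V₁ → disjoint (x∈V₁ , x∈V₂)

      class₂? : U.Decidable V₂
      class₂? x with component? x
      ... | no  x∉C = no (x∉C ∘ class⊆C false)
      ... | yes x∈C with proj₁ cover x∈C
      ...   | inj₁ x∈V₁ = no λ x∈V₂ → disjoint (x∈V₁ , x∈V₂)
      ...   | inj₂ x∈V₂ = yes x∈V₂

    -- Deciding reachability turns the negative hypothesis into an actual odd closed walk at `root`,
    -- since its absence would yield a bipartition. All lifts of vertices of `C` are then joined
    -- through `(true , root)`.
    nonbipartite-connected : ¬ Bipartite F C →
      ∀ p q {x y} → x ∈ C → y ∈ C → Walkᴰ (p , x) (q , y)
    nonbipartite-connected ¬bip p q x∈C y∈C
      with walkᴰ? (true , root) (false , root)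
    ... | yes odd = D.walk-trans (D.walk-sym (from-root x∈C p)) (from-root y∈C q)
      where
      from-root : ∀ {w} → w ∈ C → ∀ p → Walkᴰ (true , root) (p , w)
      from-root w∈C = oddClosed⇒connected odd (proj₁ C≐ w∈C)
    ... | no ¬odd = contradiction (_ , _ , record
        { cover    = proj₁ cover ∘ proj₁ C≐ , proj₂ C≐ ∘ proj₂ cover
        ; disjoint = disjoint
        ; stable₁  = stable₁
        ; stable₂  = stable₂
        }) ¬bip
      where open IsBipartition (noOddClosed⇒bipartition ¬odd)

    -- Serves to decide equality of members of `𝓕`, on which adjacency in the intersection graph
    -- depends.
    IsS? : ∀ {u v : Fin n} {S} → IsS F u v C S → U.Decidable S
    IsS? {u = u} {v} (bipartite bip S≐) s = map′ (proj₂ S≐) (proj₁ S≐)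
      ((((u Fin.≟_) ×? class₁? bip) ∪? ((v Fin.≟_) ×? class₂? bip)) s)
    IsS? {u = u} {v} (nonbipartite _ S≐) s = map′ (proj₂ S≐) (proj₁ S≐)
      ((((u Fin.≟_) ∪? (v Fin.≟_)) ×? component?) s)

    -- The sides `p` and `q` place `s` and `t` in `doubleCover`, where the walk lives; `embed` later
    -- draws it in the product.
    IsS-connected : ∀ {u v : Fin n} {S} → IsS F u v C S →
      ∀ {s t} → s ∈ S → t ∈ S → ∃[ p ] ∃[ q ]
        proj₁ s ≡ side u v p × proj₁ t ≡ side u v q × Walkᴰ (p , proj₂ s) (q , proj₂ t)
    IsS-connected {u = u} {v} (bipartite {V₁} {V₂} bip S≐) s∈S t∈S
      with locate (proj₁ S≐ s∈S) | locate (proj₁ S≐ t∈S)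
      where
      locate : ∀ {s} → s ∈ (｛ u ｝ ⟨×⟩ V₁) ∪ (｛ v ｝ ⟨×⟩ V₂) →
               ∃[ p ] proj₁ s ≡ side u v p × proj₂ s ∈ class bip p
      locate (inj₁ (refl , x∈)) = true  , refl , x∈
      locate (inj₂ (refl , x∈)) = false , refl , x∈
    ... | p , s≡ , s∈ | q , t≡ , t∈ = p , q , s≡ , t≡ , bipartite-connected bip p q s∈ t∈
    IsS-connected {u = u} {v} (nonbipartite ¬bip S≐) s∈S t∈S
      with locate (proj₁ (proj₁ S≐ s∈S)) | locate (proj₁ (proj₁ S≐ t∈S))
      where
      locate : ∀ {w} → w ∈ ｛ u ｝ ∪ ｛ v ｝ → ∃[ p ] w ≡ side u v p
      locate (inj₁ refl) = true  , refl
      locate (inj₂ refl) = false , refl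
    ... | p , s≡ | q , t≡ = p , q , s≡ , t≡ ,
      nonbipartite-connected ¬bip p q (proj₂ (proj₁ S≐ s∈S)) (proj₂ (proj₁ S≐ t∈S))

    IsS-inhabited : ∀ {u v : Fin n} {S} → IsS F u v C S → ∃[ s ] s ∈ S
    IsS-inhabited (bipartite bip S≐)
      with proj₁ (IsBipartition.cover bip) (proj₂ C≐ (stop refl))
    ... | inj₁ x∈V₁ = _ , proj₂ S≐ (inj₁ (refl , x∈V₁))
    ... | inj₂ x∈V₂ = _ , proj₂ S≐ (inj₂ (refl , x∈V₂))
    IsS-inhabited (nonbipartite _ S≐) =
      _ , proj₂ S≐ (inj₁ refl , proj₂ C≐ (stop refl))

  -- The set S_u(C) for the component C of x with x in its first class.
  IsS-around : ∀ (u v : Fin n) x → ∃[ S ] IsS F u v (Walk x) S × (u , x) ∈ S ×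
               (∀ {y} → Adj x y → (v , y) ∈ S)
  IsS-around u v x with walkᴰ? (true , x) (false , x)
  ... | no ¬odd = _ , bipartite (noOddClosed⇒bipartition ¬odd) (id , id) ,
    inj₁ (refl , stop refl) , λ xy → inj₂ (refl , D.walk-edge (refl , xy))
  ... | yes odd = _ , nonbipartite ¬bip (id , id) ,
    (inj₁ refl , stop refl) , λ xy → inj₂ refl , walk-edge xy
    where
    comp : IsComponent F (Walk x)
    comp = x , id , id

    ¬bip : ¬ Bipartite F (Walk x)
    -- Both ends of `odd` lie over `x`, on opposite sides, so `class-walk` puts `x` in both classes;
    -- the walk is reversed when `x` is known to lie in the second class.
    ¬bip (_ , _ , bip) with proj₁ (IsBipartition.cover bip) (stop refl)
    ... | inj₁ x∈V₁ = IsBipartition.disjoint bip (x∈V₁ , class-walk comp bip odd x∈V₁)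
    ... | inj₂ x∈V₂ =
      IsBipartition.disjoint bip (class-walk comp bip (D.walk-sym odd) x∈V₂ , x∈V₂)

-- Transfer of walks between the product and the intersection graph.

⊆-dec : {S T : Pred (Fin n × Fin m) 0ℓ} → U.Decidable S → U.Decidable T → Dec (S U.⊆ T)
⊆-dec S? T? = map′ (λ S⊆T {s} → S⊆T (proj₁ s) (proj₂ s)) (λ S⊆T u x → S⊆T {u , x})
  (Fin.all? λ u → Fin.all? λ x → S? (u , x) →-dec T? (u , x))

module _ (G : FiniteGraph n) {I : Set a} (Γ : I → FiniteGraph m) (h : Edges G ⟶ₛ setoid I) where
  open Graph (product G Γ h) using () renaming (Walk to Walk⊗; Connected to Connected⊗)
  open Graph (intersectionGraph (𝓕 G Γ h)) using ()
    renaming (Walk to Walkᴵ; Connected to Connectedᴵ)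
  module P = Walks (product G Γ h)
  module X = Walks (intersectionGraph (𝓕 G Γ h))

  module _ {u v} (uv : FiniteGraph.Adj G u v) where
    open Component (label G Γ h uv)

    embed : ∀ {p q x y} → Graph.Walk doubleCover (p , x) (q , y) →
            Walk⊗ (side u v p , x) (side u v q , y)
    embed (stop refl)                   = stop refl
    embed {true}  (step (refl , xz) zy) = step (uv , xz) (embed zy)
    -- The step leads from `v` to `u`, while `xz` belongs to the label of `uv`. Symmetry of the
    -- product applies because `h` ignores the orientation of an edge.
    embed {false} (step (refl , xz) zy) =
      step (Graph.Adj-sym (product G Γ h) (uv , FiniteGraph.Adj-sym (label G Γ h uv) xz)) (embed zy)

  𝓕-connected : ∀ {S} → 𝓕 G Γ h S → ∀ {s t} → s ∈ S → t ∈ S → Walk⊗ s t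
  𝓕-connected (u , v , uv , C , comp , isS) s∈S t∈S
    with Component.IsS-connected (label G Γ h uv) comp isS s∈S t∈S
  ... | _ , _ , refl , refl , w = embed uv w

  𝓕-inhabited : ∀ {S} → 𝓕 G Γ h S → ∃[ s ] s ∈ S
  𝓕-inhabited (_ , _ , uv , _ , comp , isS) = Component.IsS-inhabited (label G Γ h uv) comp isS

  𝓕? : ∀ {S} → 𝓕 G Γ h S → U.Decidable S
  𝓕? (_ , _ , uv , _ , comp , isS) = Component.IsS? (label G Γ h uv) comp isS

  -- The last component places every edge of the product from `(u , x)` along `uv` inside a single
  -- member.
  𝓕-around : ∀ {u v} (uv : FiniteGraph.Adj G u v) x → ∃[ S ] 𝓕 G Γ h S × (u , x) ∈ S ×
             (∀ {y} → FiniteGraph.Adj (label G Γ h uv) x y → (v , y) ∈ S)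
  𝓕-around uv x with Component.IsS-around (label G Γ h uv) _ _ x
  ... | S , isS , ux∈S , adj = S , (_ , _ , uv , _ , (x , id , id) , isS) , ux∈S , adj

  -- Consecutive members share a vertex `r`, and `𝓕-connected` joins successive shared vertices
  -- within one member.
  walkᴵ⇒walk⊗ : ∀ {S T : ∃ (𝓕 G Γ h)} → Walkᴵ S T →
                ∀ {s t} → s ∈ proj₁ S → t ∈ proj₁ T → Walk⊗ s t
  walkᴵ⇒walk⊗ {S} (stop S≐T) s∈S t∈T = 𝓕-connected (proj₂ S) s∈S (proj₂ S≐T t∈T)
  walkᴵ⇒walk⊗ {S} (step (_ , _ , r∈S , r∈R) w) s∈S t∈T =
    P.walk-trans (𝓕-connected (proj₂ S) s∈S r∈S) (walkᴵ⇒walk⊗ w r∈R t∈T)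

  -- Sets that meet may be equal, and then they are one vertex, not two adjacent ones; the decision
  -- separates the two cases.
  meet⇒walkᴵ : ∀ {S T : ∃ (𝓕 G Γ h)} → proj₁ S ≬ proj₁ T → Walkᴵ S T
  meet⇒walkᴵ {S , S∈𝓕} {T , T∈𝓕} S≬T
    with ⊆-dec (𝓕? S∈𝓕) (𝓕? T∈𝓕) ×-dec ⊆-dec (𝓕? T∈𝓕) (𝓕? S∈𝓕)
  ... | yes S≐T = stop S≐T
  ... | no  S≭T = X.walk-edge (S≭T , S≬T)

  -- The first edge of the walk lies in a member `R`. It meets `S` in the start of that edge and
  -- contains its end, so `R` takes over the role of `S` for the rest of the walk.
  walk⊗⇒walkᴵ : ∀ {s t} → Walk⊗ s t → ∀ {S T : ∃ (𝓕 G Γ h)} →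
                s ∈ proj₁ S → t ∈ proj₁ T → Walkᴵ S T
  walk⊗⇒walkᴵ (stop refl) s∈S s∈T = meet⇒walkᴵ (_ , s∈S , s∈T)
  walk⊗⇒walkᴵ (step (uv , xy) w) s∈S t∈T with 𝓕-around uv _
  ... | R , R∈𝓕 , s∈R , adj =
    X.walk-trans (meet⇒walkᴵ {T = R , R∈𝓕} (_ , s∈S , s∈R)) (walk⊗⇒walkᴵ w (adj xy) t∈T)

  module _ (2≤n : 2 ≤ n) (connected : FiniteGraph.Connected G) where

    -- Some edge at `u` supplies a member around `(u , x)`; here nontriviality and connectedness of
    -- `G` enter.
    𝓕-covers : ∀ s → ∃[ S ] 𝓕 G Γ h S × s ∈ S
    𝓕-covers (u , x) with 𝓕-around (proj₂ (neighbour G 2≤n connected u)) x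
    ... | S , S∈𝓕 , s∈S , _ = S , S∈𝓕 , s∈S

    connected⊗⇒connectedᴵ : Connected⊗ → Connectedᴵ
    -- `Connected` asks for a vertex, and the member covering `s` is one.
    connected⊗⇒connectedᴵ (s , walk) with 𝓕-covers s
    ... | R , R∈𝓕 , _ = (R , R∈𝓕) , λ S T →
      let s , s∈S = 𝓕-inhabited (proj₂ S)
          t , t∈T = 𝓕-inhabited (proj₂ T)
      in walk⊗⇒walkᴵ (walk s t) s∈S t∈T

    connectedᴵ⇒connected⊗ : Connectedᴵ → Connected⊗
    connectedᴵ⇒connected⊗ ((_ , R∈𝓕) , walk) = proj₁ (𝓕-inhabited R∈𝓕) , λ s t →
      let S , S∈𝓕 , s∈S = 𝓕-covers s
          T , T∈𝓕 , t∈T = 𝓕-covers t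
      in walkᴵ⇒walk⊗ (walk (S , S∈𝓕) (T , T∈𝓕)) s∈S t∈T

theorem2p6 : ∀ {i : Level} {n m : ℕ} (G : FiniteGraph n) → 2 ≤ n → FiniteGraph.Connected G →
    {I : Set i} (Γ : I → FiniteGraph m) (h : Edges G ⟶ₛ setoid I) →
    Graph.Connected (product G Γ h) ⇔ Graph.Connected (intersectionGraph (𝓕 G Γ h))
theorem2p6 G 2≤n connected Γ h =
  mk⇔ (connected⊗⇒connectedᴵ G Γ h 2≤n connected) (connectedᴵ⇒connected⊗ G Γ h 2≤n connected)
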